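{- Let $a,b,n$ be non-negative integers and let $p$ be a prime. Suppose that at least one of the following holds: (i) $p$ divides none of the integers $a$, $b$, $a-b$, $n$, $a^2-nb-a+b$; (ii) $p\mid a$, $p\nmid b$ and $p\nmid n-1$. Then for any $(a,b)$-town$\pmod p$ family $\mathcal{F}\subseteq\mathscr{P}(n)$ we have $|\mathcal{F}|\leq n-1$.
   Context: $[n]=\{1,2,\ldots,n\}$ for a positive integer $n$, with the convention $[0]=\emptyset$, and $\mathscr{P}(n)$ is the power set of $[n]$; a family $\mathcal{F}\subseteq\mathscr{P}(n)$ is a set of (distinct) subsets of $[n]$. For integers $k\ge 2$ and $a,b$ (only their residues modulo $k$ matter), a family $\mathcal{F}\subseteq\mathscr{P}(n)$ is an $(a,b)$-town$\pmod k$ if for any distinct $A,B\in\mathcal{F}$ we have $|A|\equiv a\pmod k$ and $|A\cap B|\equiv b\pmod k$; that is, every set in $\mathcal{F}$ has cardinality $\equiv a\pmod k$ and every intersection of two distinct sets of $\mathcal{F}$ has cardinality $\equiv b\pmod k$.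
   Formalization: The integer n is taken to be positive: for n = 0 the claim fails under (ii), e.g. p = 2, a = 0, b = 1 and the empty family, whose size 0 is not at most −1; condition (i) already excludes n = 0. -}

module Defs where

open import Data.Fin.Subset using (Subset; _∩_; ∣_∣)
open import Data.Integer.Base using (ℤ; +_; _-_)
import Data.Integer.Divisibility as ℤ
open import Data.List.Base using (List; length)
open import Data.List.Membership.Propositional using (_∈_)
open import Data.List.Relation.Unary.Unique.Propositional using (Unique)
open import Data.Nat.Base using (ℕ)
open import Relation.Binary.PropositionalEquality using (_≢_)

infix 4 _≡_[mod_]

_≡_[mod_] : ℤ → ℤ → ℕ → Set
x ≡ y [mod k ] = (+ k) ℤ.∣ (x - y)

-- A set of subsets of [n], enumerated without repetition; `Fin n` plays the
-- role of [n].
record Family (n : ℕ) : Set where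
  field
    members : List (Subset n)
    unique  : Unique members

  card : ℕ
  card = length members

infix 4 _∈ᶠ_

_∈ᶠ_ : ∀ {n} → Subset n → Family n → Set
A ∈ᶠ F = A ∈ Family.members F

-- The size condition is imposed on every member, so it is not vacuous for a
-- family with a single member.
record IsTown {n : ℕ} (a b : ℤ) (k : ℕ) (F : Family n) : Set where
  field
    size         : ∀ {A} → A ∈ᶠ F → + ∣ A ∣ ≡ a [mod k ]
    intersection : ∀ {A B} → A ∈ᶠ F → B ∈ᶠ F → A ≢ B →
                   + ∣ A ∩ B ∣ ≡ b [mod k ]

{-# OPTIONS --safe #-}

-- If F had n members, their indicator vectors together with the all-ones
-- vector would be n + 1 vectors of length n, hence would satisfy a nontrivial
-- relation c₀ 1 + Σ cᵢ vᵢ ≡ 0 (mod p).  With C = Σ cᵢ, pairing the relation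
-- with 1 and with vⱼ gives
--   n c₀ + a C ≡ 0   and   a c₀ + (a - b) cⱼ + b C ≡ 0 ,
-- and the second family sums over j to n a c₀ + (a - b) C + n b C ≡ 0.
-- In case (i) eliminating c₀ leaves (a² - n b - a + b) C ≡ 0, in case (ii)
-- what remains is b (n - 1) C ≡ 0.  So C ≡ 0, hence all cᵢ ≡ 0, and c₀ 1 ≡ 0
-- leaves c₀ ≡ 0.
module Submission where

open import Defs
open import Data.Integer.Base using (+_; 1ℤ; _+_; _-_; _*_; _^_)
open import Data.Integer.Divisibility using (_∣_)
open import Data.Nat.Base using (ℕ; NonZero; _∸_; _≤_)
open import Data.Nat.Primality using (Prime)
open import Data.Product.Base using (_×_)
open import Data.Sum.Base using (_⊎_)
open import Relation.Nullary.Negation.Core using (¬_)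

open import Data.Bool.Base using (Bool; true; false)
open import Data.Empty using (⊥; ⊥-elim)
open import Data.Fin.Base using (Fin; zero; suc; punchIn; inject≤)
open import Data.Fin.Properties using (any?; ∀-cons; punchInᵢ≢i; inject≤-injective)
open import Data.Fin.Subset using (Subset; ⊤; _∩_; ∣_∣)
open import Data.Fin.Subset.Properties using (∣⊤∣≡n; ∩-idem; ∩-identityˡ; ∩-identityʳ)
open import Data.Integer.Base using (ℤ; 0ℤ; -_)
open import Data.Integer.Divisibility.Signed
  using (divides; _∣?_; ∣ᵤ⇒∣; ∣⇒∣ᵤ; ∣m∣n⇒∣m+n; ∣m∣n⇒∣m-n; ∣m+n∣m⇒∣n; ∣m+n∣n⇒∣m; ∣m⇒∣m*n; ∣n⇒∣m*n)
  renaming (_∣_ to _∣ₛ_)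
open import Data.Integer.Properties
  using (+-*-semiring; +-identityˡ; +-inverseʳ; *-comm; *-identityʳ; abs-*; suc-*)
open import Data.Integer.Tactic.RingSolver using (solve-∀)
open import Data.List.Base using (List; lookup)
open import Data.List.Membership.Propositional.Properties using (∈-lookup)
import Data.List.Relation.Unary.All as All
open import Data.List.Relation.Unary.AllPairs using (_∷_)
open import Data.List.Relation.Unary.Unique.Propositional using (Unique)
open import Data.Nat.Divisibility using (∣1⇒≡1) renaming (_∣_ to _∣ℕ_)
open import Data.Nat.Primality using (euclidsLemma; ¬prime[1])
open import Data.Nat.Properties using (≮⇒≥)
open import Data.Product.Base using (∃; _,_; proj₁; proj₂)
open import Data.Sum.Base using (inj₁; inj₂; map; [_,_]′)
import Data.Vec.Base as Vec
open import Data.Vec.Functional using (insertAt; removeAt) renaming (_∷_ to _∷ᵛ_)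
open import Data.Vec.Functional.Properties using (insertAt-lookup; insertAt-punchIn)
open import Data.Vec.Properties using (lookup-replicate)
open import Function.Base using (_∘_; id; case_of_)
open import Relation.Binary.PropositionalEquality
open import Relation.Nullary.Decidable using (yes; no; ¬?; decidable-stable)

open import Algebra.Properties.Semiring.Sum +-*-semiring
  using (sum; sum-remove; sum-cong-≗; ∑-distrib-+; ∑-comm; *-distribˡ-sum; *-distribʳ-sum)

private
  variable
    m n p : ℕ

-- Finite sums and divisibility.

sum-const : ∀ n x → sum {n} (λ _ → x) ≡ + n * x
sum-const ℕ.zero    x = refl
sum-const (ℕ.suc n) x = trans (cong (λ s → x + s) (sum-const n x)) (sym (suc-* (+ n) x))

∣-sum : ∀ {d} {f : Fin n → ℤ} → (∀ i → d ∣ₛ f i) → d ∣ₛ sum f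
∣-sum {n = ℕ.zero}  h = divides 0ℤ refl
∣-sum {n = ℕ.suc n} h = ∣m∣n⇒∣m+n (h zero) (∣-sum (h ∘ suc))

∣-sum-diff : ∀ {d} {f g : Fin n → ℤ} → (∀ i → d ∣ₛ f i - g i) → d ∣ₛ sum f - sum g
∣-sum-diff {n = ℕ.zero}          h = divides 0ℤ refl
∣-sum-diff {n = ℕ.suc n} {f = f} {g} h =
  subst (_ ∣ₛ_) (regroup (f zero) (g zero) (sum (f ∘ suc)) (sum (g ∘ suc)))
    (∣m∣n⇒∣m+n (h zero) (∣-sum-diff {f = f ∘ suc} {g = g ∘ suc} (h ∘ suc)))
  where
  regroup : ∀ x y s t → (x - y) + (s - t) ≡ (x + s) - (y + t)
  regroup = solve-∀

-- Linear dependence modulo a prime.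

prime-∣-* : Prime p → ∀ x y → + p ∣ₛ x * y → + p ∣ₛ x ⊎ + p ∣ₛ y
prime-∣-* {p} p-prime x y h =
  map ∣ᵤ⇒∣ ∣ᵤ⇒∣ (euclidsLemma _ _ p-prime (subst (p ∣ℕ_) (abs-* x y) (∣⇒∣ᵤ h)))

∤∣*⇒∣ : Prime p → ∀ {x y} → ¬ (+ p ∣ₛ x) → + p ∣ₛ x * y → + p ∣ₛ y
∤∣*⇒∣ p-prime {x} {y} p∤x h = [ ⊥-elim ∘ p∤x , id ]′ (prime-∣-* p-prime x y h)

-- One step of fraction-free elimination: with pivot row v r and pivot entry x,
-- a relation c among the rows x (v i) - y i (v r), i ≠ r, is a relation among
-- the original rows with coefficients x cᵢ and - Σ cᵢ yᵢ at r.
pivotRelation : (r : Fin (ℕ.suc m)) (x : ℤ) (c y : Fin m → ℤ) → Fin (ℕ.suc m) → ℤ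
pivotRelation r x c y = insertAt (λ i → x * c i) r (- sum (λ i → c i * y i))

sum-pivotRelation : (r : Fin (ℕ.suc m)) (x : ℤ) (c y : Fin m → ℤ) (w : Fin (ℕ.suc m) → ℤ) →
  sum (λ i → pivotRelation r x c y i * w i) ≡
  sum (λ i → c i * (x * w (punchIn r i) - y i * w r))
sum-pivotRelation r x c y w = begin
  sum (λ i → c′ i * w i)
    ≡⟨ sum-remove {i = r} (λ i → c′ i * w i) ⟩
  c′ r * w r + sum (λ i → c′ (punchIn r i) * w (punchIn r i))
    ≡⟨ cong₂ (λ s t → s * w r + t) (insertAt-lookup _ r _)
         (sum-cong-≗ λ i → cong (_* w (punchIn r i)) (insertAt-punchIn _ r _ i)) ⟩
  - S * w r + sum (λ i → x * c i * w (punchIn r i))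
    ≡⟨ cong (_+ sum (λ i → x * c i * w (punchIn r i))) (move-neg S (w r)) ⟩
  S * - w r + sum (λ i → x * c i * w (punchIn r i))
    ≡⟨ cong (_+ sum (λ i → x * c i * w (punchIn r i))) (*-distribʳ-sum (- w r) (λ i → c i * y i)) ⟩
  sum (λ i → c i * y i * - w r) + sum (λ i → x * c i * w (punchIn r i))
    ≡⟨ ∑-distrib-+ (λ i → c i * y i * - w r) (λ i → x * c i * w (punchIn r i)) ⟨
  sum (λ i → c i * y i * - w r + x * c i * w (punchIn r i))
    ≡⟨ sum-cong-≗ (λ i → collect (c i) (y i) (w r) x (w (punchIn r i))) ⟩
  sum (λ i → c i * (x * w (punchIn r i) - y i * w r)) ∎
  where
  open ≡-Reasoning
  c′ = pivotRelation r x c y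
  S  = sum (λ i → c i * y i)
  move-neg : ∀ s t → - s * t ≡ s * - t
  move-neg = solve-∀
  collect : ∀ c y t x u → c * y * - t + x * c * u ≡ c * (x * u - y * t)
  collect = solve-∀

-- Gaussian elimination by induction on the number of columns. It stays in the integers: no inverse
-- modulo `p` is taken, since multiplying by a pivot prime to `p` preserves nontriviality.
dependent-mod : Prime p → ∀ n (v : Fin (ℕ.suc n) → Fin n → ℤ) →
  ∃ λ (c : Fin (ℕ.suc n) → ℤ) → (∃ λ i → ¬ (+ p ∣ₛ c i)) × (∀ j → + p ∣ₛ sum (λ i → c i * v i j))
dependent-mod p-prime ℕ.zero v = (λ _ → 1ℤ) , (zero , p∤1) , λ ()
  where
  p∤1 : ¬ (+ _ ∣ₛ 1ℤ)
  p∤1 h = ¬prime[1] (subst Prime (∣1⇒≡1 (∣⇒∣ᵤ h)) p-prime)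
dependent-mod {p} p-prime (ℕ.suc n) v with any? (λ r → ¬? (+ p ∣? v r zero))
-- Column zero already vanishes modulo `p`, so it is dropped together with row zero, which gets
-- coefficient 0.
... | no no-pivot =
  let c , (i , p∤cᵢ) , relation = dependent-mod p-prime n (λ i j → v (suc i) (suc j))
  in 0ℤ ∷ᵛ c , (suc i , p∤cᵢ) , λ where
       zero    → ∣-sum {f = λ i → (0ℤ ∷ᵛ c) i * v i zero} λ i → ∣n⇒∣m*n ((0ℤ ∷ᵛ c) i) (p∣column i)
       (suc j) → subst (+ p ∣ₛ_) (sym (+-identityˡ _)) (relation j)
  where
  p∣column : ∀ r → + p ∣ₛ v r zero
  p∣column r = decidable-stable (+ p ∣? v r zero) (λ p∤ → no-pivot (r , p∤))
... | yes (r , p∤x) =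
  let c , (i , p∤cᵢ) , relation = dependent-mod p-prime n (λ i j → reduced i (suc j))
      c′ = pivotRelation r x c y
  in c′
   -- The coefficient at this row is `x * c i`, and `p` divides neither factor.
   , (punchIn r i , λ h → p∤cᵢ (∤∣*⇒∣ p-prime p∤x (subst (+ p ∣ₛ_) (insertAt-punchIn _ r _ i) h)))
   , λ where
       -- The inductive relation does not cover column zero, but the reduced entries there are
       -- exactly 0.
       zero    → subst (+ p ∣ₛ_) (sym (sum-pivotRelation r x c y (λ i → v i zero)))
                   (∣-sum {f = λ i → c i * reduced i zero} λ i →
                     ∣n⇒∣m*n (c i) (divides 0ℤ (cancel x (y i))))
       (suc j) → subst (+ p ∣ₛ_) (sym (sum-pivotRelation r x c y (λ i → v i (suc j)))) (relation j)
  where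
  x = v r zero
  y = λ i → v (punchIn r i) zero
  reduced : Fin (ℕ.suc n) → Fin (ℕ.suc n) → ℤ
  reduced i j = x * v (punchIn r i) j - y i * v r j
  cancel : ∀ x y → x * y - y * x ≡ 0ℤ
  cancel = solve-∀

-- Indicator vectors and weighted sums of intersection sizes.

indicator : Subset n → Fin n → ℤ
indicator A j = bit (Vec.lookup A j)
  where
  bit : Bool → ℤ
  bit true  = 1ℤ
  bit false = 0ℤ

indicator-⊤ : ∀ (j : Fin n) → indicator ⊤ j ≡ 1ℤ
indicator-⊤ j rewrite lookup-replicate j true = refl

sum-indicator-* : ∀ (A B : Subset n) → sum (λ j → indicator A j * indicator B j) ≡ + ∣ A ∩ B ∣
sum-indicator-* Vec.[]          Vec.[]          = refl
sum-indicator-* (true  Vec.∷ A) (true  Vec.∷ B) = cong (λ s → 1ℤ + s) (sum-indicator-* A B)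
sum-indicator-* (true  Vec.∷ A) (false Vec.∷ B) = trans (+-identityˡ _) (sum-indicator-* A B)
sum-indicator-* (false Vec.∷ A) (true  Vec.∷ B) = trans (+-identityˡ _) (sum-indicator-* A B)
sum-indicator-* (false Vec.∷ A) (false Vec.∷ B) = trans (+-identityˡ _) (sum-indicator-* A B)

-- Take the inner product of the relation with the indicator of `B` and exchange the two sums.
∣-gram : ∀ {d} (S : Fin m → Subset n) (c : Fin m → ℤ) →
  (∀ j → d ∣ₛ sum (λ i → c i * indicator (S i) j)) →
  ∀ B → d ∣ₛ sum (λ i → c i * + ∣ B ∩ S i ∣)
∣-gram {d = d} S c relation B = subst (d ∣ₛ_) swap
  (∣-sum {f = λ j → indicator B j * sum (λ i → c i * indicator (S i) j)}
    λ j → ∣n⇒∣m*n (indicator B j) (relation j))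
  where
  open ≡-Reasoning
  rotate : ∀ b c s → b * (c * s) ≡ c * (b * s)
  rotate = solve-∀
  swap : sum (λ j → indicator B j * sum (λ i → c i * indicator (S i) j))
       ≡ sum (λ i → c i * + ∣ B ∩ S i ∣)
  swap = begin
    sum (λ j → indicator B j * sum (λ i → c i * indicator (S i) j))
      ≡⟨ sum-cong-≗ (λ j → *-distribˡ-sum (indicator B j) (λ i → c i * indicator (S i) j)) ⟩
    sum (λ j → sum (λ i → indicator B j * (c i * indicator (S i) j)))
      ≡⟨ ∑-comm (λ j i → indicator B j * (c i * indicator (S i) j)) ⟩
    sum (λ i → sum (λ j → indicator B j * (c i * indicator (S i) j)))
      ≡⟨ sum-cong-≗ (λ i → trans
           (sum-cong-≗ λ j → rotate (indicator B j) (c i) (indicator (S i) j))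
           (sym (*-distribˡ-sum (c i) (λ j → indicator B j * indicator (S i) j)))) ⟩
    sum (λ i → c i * sum (λ j → indicator B j * indicator (S i) j))
      ≡⟨ sum-cong-≗ (λ i → cong (c i *_) (sum-indicator-* B (S i))) ⟩
    sum (λ i → c i * + ∣ B ∩ S i ∣) ∎

∣-weighted-diff : ∀ {d} (c g : Fin m → ℤ) x → (∀ i → d ∣ₛ g i - x) →
  d ∣ₛ sum (λ i → c i * g i) - x * sum c
∣-weighted-diff {d = d} c g x h = subst (λ s → d ∣ₛ sum (λ i → c i * g i) - s)
  (sym (*-distribˡ-sum x c))
  (∣-sum-diff {f = λ i → c i * g i} {g = λ i → x * c i} λ i →
    subst (d ∣ₛ_) (factor (c i) (g i) x) (∣n⇒∣m*n (c i) (h i)))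
  where
  factor : ∀ c g x → c * (g - x) ≡ c * g - x * c
  factor = solve-∀

-- Meant for a Gram matrix row with `a` on the diagonal and `b` elsewhere. Term `k` is split off,
-- and `a * c k + b * (sum c - c k)` is regrouped so that the full sum appears.
∣-weighted-diff-except : ∀ {d} (c g : Fin m → ℤ) k a b → d ∣ₛ g k - a →
  (∀ i → i ≢ k → d ∣ₛ g i - b) →
  d ∣ₛ sum (λ i → c i * g i) - ((a - b) * c k + b * sum c)
∣-weighted-diff-except {m = ℕ.suc m} {d} c g k a b at-k elsewhere
  rewrite sum-remove {i = k} (λ i → c i * g i) | sum-remove {i = k} c =
  subst (d ∣ₛ_) (regroup (c k) (g k) a b _ _) (∣m∣n⇒∣m+n (∣n⇒∣m*n (c k) at-k)
    (∣-weighted-diff (removeAt c k) (removeAt g k) b λ i → elsewhere _ (punchInᵢ≢i k i)))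
  where
  regroup : ∀ u g a b s t →
    u * (g - a) + (s - b * t) ≡ (u * g + s) - ((a - b) * u + b * (u + t))
  regroup = solve-∀

sum-affine : ∀ u w z (c : Fin n → ℤ) →
  sum (λ k → u + (w * c k + z)) ≡ + n * u + (w * sum c + + n * z)
sum-affine {n} u w z c = begin
  sum (λ k → u + (w * c k + z))
    ≡⟨ ∑-distrib-+ (λ _ → u) (λ k → w * c k + z) ⟩
  sum {n} (λ _ → u) + sum (λ k → w * c k + z)
    ≡⟨ cong (λ s → sum {n} (λ _ → u) + s) (∑-distrib-+ (λ k → w * c k) (λ _ → z)) ⟩
  sum {n} (λ _ → u) + (sum (λ k → w * c k) + sum {n} (λ _ → z))
    ≡⟨ cong₂ _+_ (sum-const n u) (cong₂ _+_ (sym (*-distribˡ-sum w c)) (sum-const n z)) ⟩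
  + n * u + (w * sum c + + n * z) ∎
  where open ≡-Reasoning

-- Turns distinct indices into distinct members, as the intersection condition of a town requires.
Unique-lookup-injective : ∀ {A : Set} {xs : List A} → Unique xs →
  ∀ i j → lookup xs i ≡ lookup xs j → i ≡ j
Unique-lookup-injective (_ ∷ _)  zero    zero    _  = refl
Unique-lookup-injective (x∉ ∷ _) zero    (suc j) eq = ⊥-elim (All.lookup x∉ (∈-lookup j) eq)
Unique-lookup-injective (x∉ ∷ _) (suc i) zero    eq = ⊥-elim (All.lookup x∉ (∈-lookup i) (sym eq))
Unique-lookup-injective (_ ∷ u)  (suc i) (suc j) eq = cong suc (Unique-lookup-injective u i j eq)

-- Contradiction from a relation between `⊤` and n members.

module _ {p n} (p-prime : Prime p) (a b : ℤ) (A : Fin n → Subset n)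
  (size : ∀ i → + p ∣ₛ + ∣ A i ∣ - a)
  (intersection : ∀ i j → i ≢ j → + p ∣ₛ + ∣ A i ∩ A j ∣ - b)
  (coeff : Fin (ℕ.suc n) → ℤ)
  (nontrivial : ∃ λ i → ¬ (+ p ∣ₛ coeff i))
  (vanishes : ∀ j → + p ∣ₛ sum (λ i → coeff i * indicator ((⊤ ∷ᵛ A) i) j))
  where

  private
    N : ℤ
    N = + n

    S : Fin (ℕ.suc n) → Subset n
    S = ⊤ ∷ᵛ A

    c₀ C : ℤ
    c : Fin n → ℤ
    c₀  = coeff zero
    c i = coeff (suc i)
    C   = sum c

    replace : ∀ u g x s t → + p ∣ₛ g - x → + p ∣ₛ s - t →
      + p ∣ₛ u * g + s → + p ∣ₛ u * x + t
    replace u g x s t g≡x s≡t h = subst (+ p ∣ₛ_) (regroup u g x s t)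
      (∣m∣n⇒∣m-n h (∣m∣n⇒∣m+n (∣n⇒∣m*n u g≡x) s≡t))
      where
      regroup : ∀ u g x s t → (u * g + s) - (u * (g - x) + (s - t)) ≡ u * x + t
      regroup = solve-∀

    ∣⊤∩⊤∣≡n : ∣ ⊤ {n} ∩ ⊤ ∣ ≡ n
    ∣⊤∩⊤∣≡n = trans (cong ∣_∣ (∩-idem (⊤ {n}))) (∣⊤∣≡n n)

    size-∩ : ∀ {B} k → B ≡ A k → + p ∣ₛ + ∣ B ∣ - a
    size-∩ k refl = size k

    pair-⊤ : + p ∣ₛ c₀ * N + a * C
    pair-⊤ = subst (λ x → + p ∣ₛ c₀ * + x + a * C) ∣⊤∩⊤∣≡n
      -- Only the sum is reduced modulo `p`; `g` is kept because it equals n exactly.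
      (replace c₀ g g s (a * C) (divides 0ℤ (+-inverseʳ g))
        (∣-weighted-diff c (λ i → + ∣ ⊤ ∩ A i ∣) a λ i → size-∩ i (∩-identityˡ (A i)))
        (∣-gram S coeff vanishes ⊤))
      where
      g = + ∣ ⊤ {n} ∩ ⊤ ∣
      s = sum (λ i → c i * + ∣ ⊤ ∩ A i ∣)

    pair-A : ∀ k → + p ∣ₛ c₀ * a + ((a - b) * c k + b * C)
    pair-A k = replace c₀ (+ ∣ A k ∩ ⊤ ∣) a s ((a - b) * c k + b * C)
      (size-∩ k (∩-identityʳ (A k)))
      (∣-weighted-diff-except c (λ i → + ∣ A k ∩ A i ∣) k a b
        (size-∩ k (∩-idem (A k)))
        λ i i≢k → intersection k i (i≢k ∘ sym))
      (∣-gram S coeff vanishes (A k))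
      where
      s = sum (λ i → c i * + ∣ A k ∩ A i ∣)

    -- Summing over `k` trades the separate `c k` for `C`, leaving only `c₀` and `C` as unknowns, as
    -- in `pair-⊤`.
    pair-ΣA : + p ∣ₛ N * (c₀ * a) + ((a - b) * C + N * (b * C))
    pair-ΣA = subst (+ p ∣ₛ_) (sum-affine (c₀ * a) (a - b) (b * C) c)
      (∣-sum {f = λ k → c₀ * a + ((a - b) * c k + b * C)} pair-A)

    -- Modulo `p`, `pair-A k` shrinks to `(a - b) * c k`. The assumption concerns the product
    -- `c₀ * a` because case (i) supplies it through `c₀` and case (ii) through `a`.
    ∣c : ¬ (+ p ∣ₛ a - b) → + p ∣ₛ C → + p ∣ₛ c₀ * a → ∀ k → + p ∣ₛ c k
    ∣c p∤a-b p∣C p∣c₀a k = ∤∣*⇒∣ p-prime {a - b} {c k} p∤a-b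
      (∣m+n∣n⇒∣m {m = (a - b) * c k} {b * C}
        (∣m+n∣m⇒∣n {m = c₀ * a} {(a - b) * c k + b * C} (pair-A k) p∣c₀a)
        (∣n⇒∣m*n b p∣C))

    trivial-absurd : + p ∣ₛ c₀ → (∀ k → + p ∣ₛ c k) → ⊥
    trivial-absurd p∣c₀ p∣c = proj₂ nontrivial
      (∀-cons {P = λ i → + p ∣ₛ coeff i} p∣c₀ p∣c (proj₁ nontrivial))

  noTown-i : ¬ (+ p ∣ₛ a - b) → ¬ (+ p ∣ₛ N) →
    ¬ (+ p ∣ₛ a ^ 2 - N * b - a + b) → ⊥
  noTown-i p∤a-b p∤N p∤Δ =
    trivial-absurd p∣c₀ (∣c p∤a-b p∣C (∣m⇒∣m*n a p∣c₀))
    where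
    -- The terms in `u` cancel; `a * (a * 1ℤ)` is what `a ^ 2` computes to.
    eliminate : ∀ a b N u C → a * (u * N + a * C) - (N * (u * a) + ((a - b) * C + N * (b * C)))
      ≡ (a * (a * 1ℤ) - N * b - a + b) * C
    eliminate = solve-∀
    p∣C : + p ∣ₛ C
    p∣C = ∤∣*⇒∣ p-prime {a ^ 2 - N * b - a + b} {C} p∤Δ (subst (+ p ∣ₛ_) (eliminate a b N c₀ C)
      (∣m∣n⇒∣m-n (∣n⇒∣m*n a pair-⊤) pair-ΣA))
    -- With `C` gone, `pair-⊤` leaves `c₀ * N`, so `c₀` vanishes before the `c k` do.
    p∣c₀ : + p ∣ₛ c₀
    p∣c₀ = ∤∣*⇒∣ p-prime {N} {c₀} p∤N (subst (+ p ∣ₛ_) (*-comm c₀ N)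
      (∣m+n∣n⇒∣m {m = c₀ * N} {a * C} pair-⊤ (∣n⇒∣m*n a p∣C)))

  -- As `p` divides `a` and may divide n, `c₀` is instead read off the original relation at a
  -- coordinate `j`, where `⊤` has entry 1, once every `c k` vanishes.
  noTown-ii : + p ∣ₛ a → ¬ (+ p ∣ₛ b) → ¬ (+ p ∣ₛ N - 1ℤ) → Fin n → ⊥
  noTown-ii p∣a p∤b p∤N-1 j = trivial-absurd p∣c₀ p∣c
    where
    -- Subtracting a multiple of `a`, harmless modulo `p`, removes `u` and leaves `(N * b - b) * C`.
    collect : ∀ a b N u C → (N * (u * a) + ((a - b) * C + N * (b * C))) - a * (N * u + C)
      ≡ b * ((N - 1ℤ) * C)
    collect = solve-∀
    p∣C : + p ∣ₛ C
    p∣C = ∤∣*⇒∣ p-prime {N - 1ℤ} {C} p∤N-1 (∤∣*⇒∣ p-prime {b} {(N - 1ℤ) * C} p∤b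
      (subst (+ p ∣ₛ_) (collect a b N c₀ C)
        (∣m∣n⇒∣m-n pair-ΣA (∣m⇒∣m*n (N * c₀ + C) p∣a))))
    p∤a-b : ¬ (+ p ∣ₛ a - b)
    p∤a-b h = p∤b (subst (+ p ∣ₛ_) (cancel a b) (∣m∣n⇒∣m-n p∣a h))
      where
      cancel : ∀ a b → a - (a - b) ≡ b
      cancel = solve-∀
    p∣c : ∀ k → + p ∣ₛ c k
    p∣c = ∣c p∤a-b p∣C (∣n⇒∣m*n c₀ p∣a)
    p∣c₀ : + p ∣ₛ c₀
    p∣c₀ = subst (+ p ∣ₛ_) (*-identityʳ c₀)
      (subst (λ x → + p ∣ₛ c₀ * x) (indicator-⊤ j)
        (∣m+n∣n⇒∣m {m = c₀ * indicator ⊤ j} {sum (λ k → c k * indicator (A k) j)} (vanishes j)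
          (∣-sum {f = λ k → c k * indicator (A k) j} λ k → ∣m⇒∣m*n (indicator (A k) j) (p∣c k))))

proposition2p2 : (a b n p : ℕ) .{{_ : NonZero n}} → Prime p →
    ( ¬ (+ p ∣ + a)
    × ¬ (+ p ∣ + b)
    × ¬ (+ p ∣ (+ a) - (+ b))
    × ¬ (+ p ∣ + n)
    × ¬ (+ p ∣ (+ a) ^ 2 - (+ n) * (+ b) - (+ a) + (+ b)) )
    ⊎ ( (+ p ∣ + a)
    × ¬ (+ p ∣ + b)
    × ¬ (+ p ∣ (+ n) - 1ℤ) ) →
    (F : Family n) → IsTown (+ a) (+ b) p F →
    Family.card F ≤ n ∸ 1
proposition2p2 a b (ℕ.suc n) p p-prime cond F town =
  -- The ground set has `suc n` points and `n<card` unfolds to `suc n ≤ card`, so `inject≤` selects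
  -- the first `suc n` members.
  ≮⇒≥ λ n<card → let
    A = λ i → lookup members (inject≤ i n<card)
    A-injective : ∀ {i j} → A i ≡ A j → i ≡ j
    A-injective {i} {j} eq = inject≤-injective n<card n<card i j (Unique-lookup-injective unique _ _ eq)
    A-size = λ i → ∣ᵤ⇒∣ (size (∈-lookup (inject≤ i n<card)))
    A-intersection = λ i j i≢j → ∣ᵤ⇒∣ (intersection
      (∈-lookup (inject≤ i n<card)) (∈-lookup (inject≤ j n<card)) (i≢j ∘ A-injective))
    coeff , nontrivial , vanishes = dependent-mod p-prime (ℕ.suc n) (λ i → indicator ((⊤ ∷ᵛ A) i))
  in case cond of λ where
    (inj₁ (_ , _ , p∤a-b , p∤n , p∤Δ)) →
      noTown-i p-prime (+ a) (+ b) A A-size A-intersection coeff nontrivial vanishes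
        (p∤a-b ∘ ∣⇒∣ᵤ) (p∤n ∘ ∣⇒∣ᵤ) (p∤Δ ∘ ∣⇒∣ᵤ)
    (inj₂ (p∣a , p∤b , p∤n-1)) →
      noTown-ii p-prime (+ a) (+ b) A A-size A-intersection coeff nontrivial vanishes
        -- The final `zero` is a coordinate, available since the ground set is nonempty.
        (∣ᵤ⇒∣ p∣a) (p∤b ∘ ∣⇒∣ᵤ) (p∤n-1 ∘ ∣⇒∣ᵤ) zero
  where
  open Family F
  open IsTown town
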